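{- Let $(\mathbf F,\prec)$ be an IS-family over a finite set $V$. For every integer $x\ge0$, $M(x)\le 2^x|sm(\mathbf F)|$.
   Context: Let $V$ be a finite set, $n=|V|$, $\mathbf F$ a family of subsets of $V$ and $\prec$ a strict partial order on $\mathbf F$; $S\preceq S'$ means $S\prec S'$ or $S=S'$. For $S\in\mathbf F$ and $v\in V$, $S$ covers $v$ if there is $S'\in\mathbf F$ with $S'\prec S$ and $v\in S'\setminus S$. $Pred(S)$ is the set of $S'\in\mathbf F$ with $S'\prec S$ such that there is no $S''\in\mathbf F$ with $S'\prec S''\prec S$. The visible set $Vis(S)$ is the set of $v\in V$ such that $v\in S'$ for some $S'\in Pred(S)$ and $v$ is not covered by any element of $Pred(S)$. For $S\in\mathbf F$ and $v\in S$, a witness of $v$ w.r.t. $S$ is a $\prec$-minimal element $S'\in\mathbf F$ with $S\prec S'$ and $v\in S\setminus S'$. $(\mathbf F,\prec)$ is an IS-family if: (SE) there is a unique element $sm(\mathbf F)\in\mathbf F$ with $sm(\mathbf F)\prec S$ for every other $S\in\mathbf F$; (SM) $S_1\prec S_2$ implies $|S_1|<|S_2|$; (SW) for every $S\in\mathbf F$ and $v\in S$ there is at most one witness of $v$ w.r.t. $S$; (TE) if $S_1\prec S_2\prec S_3$ are in $\mathbf F$ and $v\in S_1\setminus S_2$ then $v\in S_1\setminus S_3$; (LVS) for every $S\in\mathbf F$ and $S'\in Pred(S)$, $|S'|\le |Vis(S)|$; (DVS) for every $S\in\mathbf F$ with $S\ne sm(\mathbf F)$, $Vis(S)$ is not a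 subset of $S$; (EC) $sm(\mathbf F)$ can be computed in $O(n^3)$ time, for given $S\in\mathbf F$ and $v\in S$ the witness of $v$ w.r.t. $S$ can be computed (or its nonexistence reported) in $O(n^3)$ time, and $S_1\prec S_2$ can be tested in $O(|S_1|)$ time. Notation: $hat(S)=S\setminus\bigcup_{S'\prec S}S'$; $ex(S)=|S|-|sm(\mathbf F)|$; for $x\ge0$, $\mathbf E_x=\{S\in\mathbf F: ex(S)\le x\}$; for $S\in\mathbf E_x$, $hat_x(S)$ is the set of $v\in hat(S)$ such that there is no $S'\in\mathbf E_x$ with $S\prec S'$ and $v\in S\setminus S'$; $M(x)=\sum_{S\in\mathbf E_x}2^{x-ex(S)}|hat_x(S)|$. -}

module Defs where

open import Level using (0ℓ)
open import Data.Bool using (Bool)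
open import Data.Fin using (Fin)
open import Data.Fin.Properties using (any?)
open import Data.Fin.Subset using (Subset; _∈_; _⊆_; _─_; ⋃; ∣_∣)
open import Data.Fin.Subset.Properties using (_∈?_)
open import Data.List using (List; map; filter; allFin)
open import Data.Maybe using (Maybe; just; nothing)
open import Data.Nat using (ℕ; suc; _*_; _^_; _∸_; _≤_; _<_; _≤?_)
open import Data.Nat.ListAction using (sum)
open import Data.Product using (∃; ∃!; _×_; _,_; proj₁)
open import Data.Unit using (⊤; tt)
open import Data.Vec using (tabulate)
open import Function using (_∘_)
open import Function.Definitions using (Injective)
open import Relation.Binary using (Rel; IsDecStrictPartialOrder)
open import Relation.Binary.PropositionalEquality using (_≡_; _≢_)
open import Relation.Nullary using (¬_; Dec; does; ¬?; _×-dec_)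
open import Relation.Unary using (Pred; Decidable)

comprehension : ∀ {n} {P : Pred (Fin n) 0ℓ} → Decidable P → Subset n
comprehension P? = tabulate (does ∘ P?)

-- An arbitrary notion of algorithm with running times; `Returns a x y t` says
-- that a, run on x, returns y within t steps.  No particular machine is fixed.
record CostModel : Set₁ where
  field
    Algorithm : Set → Set → Set
    Returns   : ∀ {A B} → Algorithm A B → A → B → ℕ → Set

-- The ground set V is Fin n.  A (necessarily finite) family 𝐅 of subsets of V
-- is given by a repetition-free enumeration, so that elements of 𝐅 are indices
-- in Fin size, equality in 𝐅 is equality of indices, and ≺ is an order on 𝐅
-- itself.
record OrderedFamily (n : ℕ) : Set₁ where
  infix 4 _≺_
  field
    size                    : ℕ
    set                     : Fin size → Subset n
    set-injective           : Injective _≡_ _≡_ set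
    _≺_                     : Rel (Fin size) 0ℓ
    isDecStrictPartialOrder : IsDecStrictPartialOrder _≡_ _≺_

  open IsDecStrictPartialOrder isDecStrictPartialOrder public
    using () renaming (_<?_ to _≺?_)

  𝐅 : Set
  𝐅 = Fin size

  Covers : 𝐅 → Fin n → Set
  Covers S v = ∃ λ S′ → S′ ≺ S × v ∈ set S′ ─ set S

  covers? : ∀ S v → Dec (Covers S v)
  covers? S v = any? λ S′ → (S′ ≺? S) ×-dec (v ∈? set S′ ─ set S)

  _∈Pred_ : 𝐅 → 𝐅 → Set
  S′ ∈Pred S = S′ ≺ S × ¬ (∃ λ S″ → S′ ≺ S″ × S″ ≺ S)

  _∈Pred?_ : ∀ S′ S → Dec (S′ ∈Pred S)
  S′ ∈Pred? S = (S′ ≺? S) ×-dec ¬? (any? λ S″ → (S′ ≺? S″) ×-dec (S″ ≺? S))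

  Visible : 𝐅 → Fin n → Set
  Visible S v = (∃ λ S′ → S′ ∈Pred S × v ∈ set S′)
              × ¬ (∃ λ S′ → S′ ∈Pred S × Covers S′ v)

  visible? : ∀ S v → Dec (Visible S v)
  visible? S v = (any? λ S′ → (S′ ∈Pred? S) ×-dec (v ∈? set S′))
           ×-dec ¬? (any? λ S′ → (S′ ∈Pred? S) ×-dec covers? S′ v)

  Vis : 𝐅 → Subset n
  Vis S = comprehension (visible? S)

  Excludes : 𝐅 → Fin n → 𝐅 → Set
  Excludes S v S′ = S ≺ S′ × v ∈ set S ─ set S′

  excludes? : ∀ S v S′ → Dec (Excludes S v S′)
  excludes? S v S′ = (S ≺? S′) ×-dec (v ∈? set S ─ set S′)

  IsWitness : 𝐅 → Fin n → 𝐅 → Set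
  IsWitness S v S′ = Excludes S v S′ × ¬ (∃ λ S″ → Excludes S v S″ × S″ ≺ S′)

  hat : 𝐅 → Subset n
  hat S = set S ─ ⋃ (map set (filter (_≺? S) (allFin size)))

  IsSmallest : 𝐅 → Set
  IsSmallest S₀ = ∀ S → S ≢ S₀ → S₀ ≺ S

  WitnessAnswer : 𝐅 → Fin n → Maybe (Subset n) → Set
  WitnessAnswer S v (just T) = ∃ λ S′ → IsWitness S v S′ × set S′ ≡ T
  WitnessAnswer S v nothing  = ∀ S′ → ¬ IsWitness S v S′

-- Bounds O(f) are read as c * suc f, which for f ≥ 1 is the usual notion and
-- for f = 0 allows constant time.
record EfficientlyComputable {n : ℕ} (model : CostModel) (fam : OrderedFamily n)
                             (sm : OrderedFamily.𝐅 fam) : Set₁ where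
  open CostModel model
  open OrderedFamily fam
  field
    sm-computable      : ∃ λ (a : Algorithm ⊤ (Subset n)) → ∃ λ c →
                         Returns a tt (set sm) (c * suc (n ^ 3))
    witness-computable : ∃ λ (a : Algorithm (Subset n × Fin n) (Maybe (Subset n))) → ∃ λ c →
                         ∀ S v → v ∈ set S → ∃ λ r →
                         Returns a (set S , v) r (c * suc (n ^ 3)) × WitnessAnswer S v r
    ≺-computable       : ∃ λ (a : Algorithm (Subset n × Subset n) Bool) → ∃ λ c →
                         ∀ S₁ S₂ →
                         Returns a (set S₁ , set S₂) (does (S₁ ≺? S₂)) (c * suc ∣ set S₁ ∣)

record IsISFamily {n : ℕ} (model : CostModel) (fam : OrderedFamily n) : Set₁ where
  open OrderedFamily fam
  field
    SE : ∃! _≡_ IsSmallest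

  sm : 𝐅
  sm = proj₁ SE

  field
    SM  : ∀ S₁ S₂ → S₁ ≺ S₂ → ∣ set S₁ ∣ < ∣ set S₂ ∣
    SW  : ∀ S v → v ∈ set S → ∀ S′ S″ → IsWitness S v S′ → IsWitness S v S″ → S′ ≡ S″
    TE  : ∀ S₁ S₂ S₃ v → S₁ ≺ S₂ → S₂ ≺ S₃ →
          v ∈ set S₁ ─ set S₂ → v ∈ set S₁ ─ set S₃
    LVS : ∀ S S′ → S′ ∈Pred S → ∣ set S′ ∣ ≤ ∣ Vis S ∣
    DVS : ∀ S → S ≢ sm → ¬ (Vis S ⊆ set S)
    EC  : EfficientlyComputable model fam sm

  -- By SE and SM, |sm| ≤ |S| for all S, so the subtraction is never truncated.
  ex : 𝐅 → ℕ
  ex S = ∣ set S ∣ ∸ ∣ set sm ∣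

  𝐄 : ℕ → List 𝐅
  𝐄 x = filter (λ S → ex S ≤? x) (allFin size)

  InHat : ℕ → 𝐅 → Fin n → Set
  InHat x S v = v ∈ hat S × ¬ (∃ λ S′ → ex S′ ≤ x × Excludes S v S′)

  inHat? : ∀ x S v → Dec (InHat x S v)
  inHat? x S v = (v ∈? hat S) ×-dec ¬? (any? λ S′ → (ex S′ ≤? x) ×-dec excludes? S v S′)

  hatAt : ℕ → 𝐅 → Subset n
  hatAt x S = comprehension (inHat? x S)

  M : ℕ → ℕ
  M x = sum (map (λ S → 2 ^ (x ∸ ex S) * ∣ hatAt x S ∣) (𝐄 x))

{-# OPTIONS --safe #-}

-- M(0) ≤ |sm|, and M(x+1) ≤ 2 M(x) by charging.  Let ex(T) = x+1,
-- k = |Vis(T) \ T| and d = |T| ∸ |Vis(T)|.  Each v ∈ Vis(T) \ T lies in hat(S)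
-- for some S ≺ T below a predecessor of T, and T is the witness of v w.r.t. S
-- because v is covered by no predecessor of T.  So v leaves hat(S) exactly
-- when x grows to x+1, and by (SW) the pair (S , v) is charged by T only.
-- This frees a weight 2^(|T|-|S|) ≥ 2^d by (LVS), in total at least k 2^d, which
-- by (DVS) is at least k + d; and hat(T) ⊆ T \ Vis(T) gives |hat(T)| ≤ k + d.
module Submission where

open import Defs
open import Data.Bool using (if_then_else_)
open import Data.Fin using (Fin; zero; suc)
open import Data.Fin.Induction using (spo-wellFounded; spo-noetherian)
open import Data.Fin.Properties using (any?; suc-injective; 0≢1+n) renaming (_≟_ to _≟ᶠ_)
open import Data.Fin.Subset using (Subset; inside; outside; _∈_; _∉_; _⊆_; _─_; ⋃; ∣_∣)
open import Data.Fin.Subset.Properties using (_∈?_; ∉⊥; x∈p∪q⁺; x∈p∪q⁻; x∈p∧x∉q⇒x∈p─q; p─q⊆p; p⊆q⇒∣p∣≤∣q∣)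
open import Data.List using (List; []; _∷_; map; filter; allFin) renaming (tabulate to tabulateᴸ)
open import Data.List.Membership.Propositional using () renaming (_∈_ to _∈ᴸ_)
open import Data.List.Membership.Propositional.Properties using (∈-map⁺; ∈-map⁻; ∈-filter⁺; ∈-filter⁻; ∈-allFin)
open import Data.List.Relation.Unary.Any using () renaming (here to hereᴸ; there to thereᴸ)
open import Data.Nat using (ℕ; zero; suc; _+_; _*_; _^_; _∸_; _≤_; _<_; _≤?_; z≤n; s≤s; s≤s⁻¹; NonZero; >-nonZero)
open import Data.Nat.ListAction using () renaming (sum to sumᴸ)
open import Data.Nat.Properties hiding (suc-injective; 0≢1+n)
open import Data.Product using (∃; _×_; _,_; proj₁; proj₂)
open import Data.Sum using (_⊎_; inj₁; inj₂)
open import Data.Vec using ([]; _∷_; here; there)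
open import Data.Vec.Properties using ([]=⇒lookup; lookup⇒[]=; lookup∘tabulate)
open import Function using (_∘_; id; flip)
open import Induction.WellFounded using (Acc; acc)
open import Level using (0ℓ)
open import Relation.Binary using (IsDecStrictPartialOrder)
open import Relation.Binary.PropositionalEquality using (_≡_; _≢_; refl; sym; trans; cong; cong₂; subst)
open import Relation.Nullary using (¬_; Dec; yes; no; does; ¬?; _×-dec_; contradiction)
open import Relation.Nullary.Decidable using (decidable-stable; dec-true)
open import Relation.Unary using (Pred; Decidable)
open import Algebra.Properties.Semiring.Sum +-*-semiring using (sum; sum-syntax; sum-cong-≗; ∑-distrib-+; ∑-comm; *-distribˡ-sum)

private
  variable
    n : ℕ
    A : Set

-- Indicators and finite sums

⟦_⟧ : Dec A → ℕ
⟦ a? ⟧ = if does a? then 1 else 0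

⟦⟧-true : (a? : Dec A) → A → ⟦ a? ⟧ ≡ 1
⟦⟧-true (yes _) a = refl
⟦⟧-true (no ¬a) a = contradiction a ¬a

⟦⟧-false : (a? : Dec A) → ¬ A → ⟦ a? ⟧ ≡ 0
⟦⟧-false (yes a) ¬a = contradiction a ¬a
⟦⟧-false (no _)  ¬a = refl

∑-mono : {f g : Fin n → ℕ} → (∀ i → f i ≤ g i) → ∑[ i < n ] f i ≤ ∑[ i < n ] g i
∑-mono {zero}  f≤g = z≤n
∑-mono {suc n} f≤g = +-mono-≤ (f≤g zero) (∑-mono (f≤g ∘ suc))

∑-zero : {f : Fin n → ℕ} → (∀ i → f i ≡ 0) → ∑[ i < n ] f i ≡ 0
∑-zero {zero}  f≡0 = refl
∑-zero {suc n} f≡0 = cong₂ _+_ (f≡0 zero) (∑-zero (f≡0 ∘ suc))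

term≤∑ : (f : Fin n → ℕ) (i : Fin n) → f i ≤ ∑[ j < n ] f j
term≤∑ f zero    = m≤m+n _ _
term≤∑ f (suc i) = ≤-trans (term≤∑ (f ∘ suc) i) (m≤n+m _ _)

∑⟦⟧≤1 : {P : Pred (Fin n) 0ℓ} (P? : Decidable P) →
        (∀ {i j} → P i → P j → i ≡ j) → ∑[ i < n ] ⟦ P? i ⟧ ≤ 1
∑⟦⟧≤1 {zero}  P? unique = z≤n
∑⟦⟧≤1 {suc n} P? unique with P? zero
... | yes p = s≤s (≤-reflexive (∑-zero λ i → ⟦⟧-false (P? (suc i)) λ q → 0≢1+n (unique p q)))
... | no  _ = ∑⟦⟧≤1 (P? ∘ suc) λ p q → suc-injective (unique p q)

-- The filter becomes an indicator factor, so that sums over part of the family range over all of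
-- `Fin n` and can be interchanged freely.
sum-filter-tabulate : {P : Pred A 0ℓ} (P? : Decidable P) (f : A → ℕ) (g : Fin n → A) →
  sumᴸ (map f (filter P? (tabulateᴸ g))) ≡ ∑[ i < n ] (⟦ P? (g i) ⟧ * f (g i))
sum-filter-tabulate {n = zero}  P? f g = refl
sum-filter-tabulate {n = suc n} P? f g with P? (g zero)
... | yes _ = cong₂ _+_ (sym (+-identityʳ _)) (sum-filter-tabulate P? f (g ∘ suc))
... | no  _ = sum-filter-tabulate P? f (g ∘ suc)

n<2^n : ∀ m → m < 2 ^ m
n<2^n zero    = s≤s z≤n
n<2^n (suc m) = begin
  1 + suc m            ≤⟨ +-mono-≤ (m^n>0 2 m) (n<2^n m) ⟩
  2 ^ m + 2 ^ m        ≡⟨ cong (2 ^ m +_) (sym (+-identityʳ _)) ⟩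
  2 ^ suc m            ∎
  where open ≤-Reasoning

-- For `k ≥ 1`, `d ≤ d * k` gives `k + d ≤ (1 + d) * k`, and `1 + d ≤ 2 ^ d`. Positivity of `k` is
-- essential: the bound fails for `k = 0`, `d > 0`.
k+d≤2^d*k : ∀ d {k} → 0 < k → k + d ≤ 2 ^ d * k
k+d≤2^d*k d {k} 0<k = begin
  k + d        ≤⟨ +-monoʳ-≤ k (m≤m*n d k) ⟩
  suc d * k    ≤⟨ *-monoˡ-≤ k (n<2^n d) ⟩
  2 ^ d * k    ∎
  where
  open ≤-Reasoning
  instance
    _ : NonZero k
    _ = >-nonZero 0<k

-- Subsets

∣p∣≡∑ : (p : Subset n) → ∣ p ∣ ≡ ∑[ v < n ] ⟦ v ∈? p ⟧
∣p∣≡∑ []            = refl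
∣p∣≡∑ (inside  ∷ p) = cong suc (∣p∣≡∑ p)
∣p∣≡∑ (outside ∷ p) = ∣p∣≡∑ p

x∈p─q⇒x∉q : ∀ {x} (p q : Subset n) → x ∈ p ─ q → x ∉ q
x∈p─q⇒x∉q (_ ∷ p) (inside  ∷ q) (there x∈) (there x∈q) = x∈p─q⇒x∉q p q x∈ x∈q
x∈p─q⇒x∉q (_ ∷ p) (outside ∷ q) (there x∈) (there x∈q) = x∈p─q⇒x∉q p q x∈ x∈q

x∈⋃⁺ : ∀ {x} {p : Subset n} {ps} → p ∈ᴸ ps → x ∈ p → x ∈ ⋃ ps
x∈⋃⁺ (hereᴸ refl)  x∈p = x∈p∪q⁺ (inj₁ x∈p)
x∈⋃⁺ (thereᴸ p∈ps) x∈p = x∈p∪q⁺ (inj₂ (x∈⋃⁺ p∈ps x∈p))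

x∈⋃⁻ : ∀ {x} (ps : List (Subset n)) → x ∈ ⋃ ps → ∃ λ p → p ∈ᴸ ps × x ∈ p
x∈⋃⁻ []       x∈⊥ = contradiction x∈⊥ ∉⊥
x∈⋃⁻ (p ∷ ps) x∈  with x∈p∪q⁻ p (⋃ ps) x∈
... | inj₁ x∈p = p , hereᴸ refl , x∈p
... | inj₂ x∈⋃ with x∈⋃⁻ ps x∈⋃
...   | q , q∈ps , x∈q = q , thereᴸ q∈ps , x∈q

module _ {P : Pred (Fin n) 0ℓ} (P? : Decidable P) where

  ∈-comprehension⁺ : ∀ {v} → P v → v ∈ comprehension P?
  ∈-comprehension⁺ {v} Pv =
    lookup⇒[]= v _ (trans (lookup∘tabulate (does ∘ P?) v) (dec-true (P? v) Pv))

  ∈-comprehension⁻ : ∀ {v} → v ∈ comprehension P? → P v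
  ∈-comprehension⁻ {v} v∈ with P? v | trans (sym (lookup∘tabulate (does ∘ P?) v)) ([]=⇒lookup v∈)
  ... | yes Pv | _  = Pv
  ... | no _   | ()

-- Ordered families

module OrderedFamilyProperties (fam : OrderedFamily n) where
  open OrderedFamily fam
  open IsDecStrictPartialOrder isDecStrictPartialOrder
    using (isStrictPartialOrder) renaming (trans to ≺-trans)

  infix 4 _⪯_
  _⪯_ : 𝐅 → 𝐅 → Set
  S ⪯ S′ = S ≺ S′ ⊎ S ≡ S′

  ⪯-≺-trans : ∀ {S₁ S₂ S₃} → S₁ ⪯ S₂ → S₂ ≺ S₃ → S₁ ≺ S₃
  ⪯-≺-trans (inj₁ S₁≺S₂) S₂≺S₃ = ≺-trans S₁≺S₂ S₂≺S₃
  ⪯-≺-trans (inj₂ refl)  S₂≺S₃ = S₂≺S₃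

  ≺-⪯-trans : ∀ {S₁ S₂ S₃} → S₁ ≺ S₂ → S₂ ⪯ S₃ → S₁ ≺ S₃
  ≺-⪯-trans S₁≺S₂ (inj₁ S₂≺S₃) = ≺-trans S₁≺S₂ S₂≺S₃
  ≺-⪯-trans S₁≺S₂ (inj₂ refl)  = S₁≺S₂

  -- Descent along `≺`, well-founded because the family is finite. The minimality clause has the
  -- shape used in `IsWitness`, so for `P = Excludes S v` the result is a witness as it stands.
  minimal-below : {P : Pred 𝐅 0ℓ} → Decidable P → ∀ {S} → P S →
                  ∃ λ S₀ → S₀ ⪯ S × P S₀ × ¬ (∃ λ S′ → P S′ × S′ ≺ S₀)
  minimal-below {P} P? {S} = go (spo-wellFounded isStrictPartialOrder S)
    where
    go : ∀ {S} → Acc _≺_ S → P S →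
         ∃ λ S₀ → S₀ ⪯ S × P S₀ × ¬ (∃ λ S′ → P S′ × S′ ≺ S₀)
    go {S} (acc rs) PS with any? (λ S′ → P? S′ ×-dec (S′ ≺? S))
    ... | no minimal = S , inj₂ refl , PS , minimal
    ... | yes (S′ , PS′ , S′≺S) with go (rs S′≺S) PS′
    ...   | S₀ , S₀⪯S′ , rest = S₀ , inj₁ (⪯-≺-trans S₀⪯S′ S′≺S) , rest

  -- The upward counterpart: climb from `S` while some set lies strictly between it and `T`.
  pred-above : ∀ {S T} → S ≺ T → ∃ λ P → S ⪯ P × P ∈Pred T
  pred-above {S} {T} = go (spo-noetherian isStrictPartialOrder S)
    where
    go : ∀ {S} → Acc (flip _≺_) S → S ≺ T → ∃ λ P → S ⪯ P × P ∈Pred T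
    go {S} (acc rs) S≺T with any? (λ S′ → (S ≺? S′) ×-dec (S′ ≺? T))
    ... | no maximal = S , inj₂ refl , S≺T , maximal
    ... | yes (S′ , S≺S′ , S′≺T) with go (rs S≺S′) S′≺T
    ...   | P , S′⪯P , P∈Pred = P , inj₁ (≺-⪯-trans S≺S′ S′⪯P) , P∈Pred

  isWitness? : ∀ S v S′ → Dec (IsWitness S v S′)
  isWitness? S v S′ =
    excludes? S v S′ ×-dec ¬? (any? λ S″ → excludes? S v S″ ×-dec (S″ ≺? S′))

  ∈-hat⁺ : ∀ {S v} → v ∈ set S → (∀ {S′} → S′ ≺ S → v ∉ set S′) → v ∈ hat S
  ∈-hat⁺ {S} {v} v∈S v∉below = x∈p∧x∉q⇒x∈p─q v∈S v∉⋃
    where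
    v∉⋃ : v ∉ ⋃ (map set (filter (_≺? S) (allFin size)))
    v∉⋃ v∈⋃ with x∈⋃⁻ _ v∈⋃
    ... | p , p∈ , v∈p with ∈-map⁻ set p∈
    ...   | S′ , S′∈ , refl = v∉below (proj₂ (∈-filter⁻ (_≺? S) {xs = allFin size} S′∈)) v∈p

  hat⊆set : ∀ S → hat S ⊆ set S
  hat⊆set S = p─q⊆p (set S) _

  ∈-hat⇒∉-below : ∀ {S S′ v} → v ∈ hat S → S′ ≺ S → v ∉ set S′
  ∈-hat⇒∉-below {S} {S′} v∈hat S′≺S v∈S′ =
    x∈p─q⇒x∉q (set S) _ v∈hat
      (x∈⋃⁺ (∈-map⁺ set (∈-filter⁺ (_≺? S) (∈-allFin S′) S′≺S)) v∈S′)

  -- `hat T` and `Vis T` are disjoint, and both lie in the union of `set T` and `Vis T ─ set T`.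
  -- Adding `∣ Vis T ∣` to both sides turns this into a vertexwise comparison of indicators.
  ∣hat∣≤ : ∀ T → ∣ hat T ∣ ≤ ∣ Vis T ─ set T ∣ + (∣ set T ∣ ∸ ∣ Vis T ∣)
  ∣hat∣≤ T = +-cancelʳ-≤ ∣ Vis T ∣ _ _ (begin
    ∣ hat T ∣ + ∣ Vis T ∣
      ≡⟨ cong₂ _+_ (∣p∣≡∑ (hat T)) (∣p∣≡∑ (Vis T)) ⟩
    ∑[ v < n ] ⟦ v ∈? hat T ⟧ + ∑[ v < n ] ⟦ v ∈? Vis T ⟧
      ≡⟨ ∑-distrib-+ {n} _ _ ⟨
    ∑[ v < n ] (⟦ v ∈? hat T ⟧ + ⟦ v ∈? Vis T ⟧)
      ≤⟨ ∑-mono pointwise ⟩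
    ∑[ v < n ] (⟦ v ∈? Vis T ─ set T ⟧ + ⟦ v ∈? set T ⟧)
      ≡⟨ ∑-distrib-+ {n} _ _ ⟩
    ∑[ v < n ] ⟦ v ∈? Vis T ─ set T ⟧ + ∑[ v < n ] ⟦ v ∈? set T ⟧
      ≡⟨ cong₂ _+_ (∣p∣≡∑ (Vis T ─ set T)) (∣p∣≡∑ (set T)) ⟨
    ∣ Vis T ─ set T ∣ + ∣ set T ∣
      -- Holds also when `Vis T` is larger than `set T` and the difference truncates to `0`.
      ≤⟨ +-monoʳ-≤ ∣ Vis T ─ set T ∣ (m≤n+m∸n ∣ set T ∣ ∣ Vis T ∣) ⟩
    ∣ Vis T ─ set T ∣ + (∣ Vis T ∣ + (∣ set T ∣ ∸ ∣ Vis T ∣))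
      ≡⟨ cong (∣ Vis T ─ set T ∣ +_) (+-comm ∣ Vis T ∣ _) ⟩
    ∣ Vis T ─ set T ∣ + ((∣ set T ∣ ∸ ∣ Vis T ∣) + ∣ Vis T ∣)
      ≡⟨ +-assoc ∣ Vis T ─ set T ∣ _ _ ⟨
    ∣ Vis T ─ set T ∣ + (∣ set T ∣ ∸ ∣ Vis T ∣) + ∣ Vis T ∣ ∎)
    where
    open ≤-Reasoning
    pointwise : ∀ v → ⟦ v ∈? hat T ⟧ + ⟦ v ∈? Vis T ⟧ ≤ ⟦ v ∈? Vis T ─ set T ⟧ + ⟦ v ∈? set T ⟧
    pointwise v with v ∈? hat T | v ∈? Vis T | v ∈? set T
    ... | yes v∈hat | yes v∈Vis | _ with ∈-comprehension⁻ (visible? T) v∈Vis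
    -- A visible vertex lies in a set below `T`, which `hat T` rules out.
    ...   | (P , (P≺T , _) , v∈P) , _ = contradiction v∈P (∈-hat⇒∉-below v∈hat P≺T)
    pointwise v | yes v∈hat | no _      | yes _   = m≤n+m 1 _
    pointwise v | yes v∈hat | no _      | no v∉T  = contradiction (hat⊆set T v∈hat) v∉T
    pointwise v | no _      | yes _     | yes _   = m≤n+m 1 _
    pointwise v | no _      | yes v∈Vis | no v∉T  =
      ≤-reflexive (sym (cong (_+ 0) (⟦⟧-true (v ∈? Vis T ─ set T) (x∈p∧x∉q⇒x∈p─q v∈Vis v∉T))))
    pointwise v | no _      | no _      | _       = z≤n

-- IS-families

module ISFamilyProperties (model : CostModel) (fam : OrderedFamily n)
                          (is : IsISFamily model fam) where
  open OrderedFamily fam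
  open OrderedFamilyProperties fam
  open IsISFamily is

  -- Sizes and excess.

  ∣∣-mono : ∀ {S T} → S ⪯ T → ∣ set S ∣ ≤ ∣ set T ∣
  ∣∣-mono (inj₁ S≺T)  = <⇒≤ (SM _ _ S≺T)
  ∣∣-mono (inj₂ refl) = ≤-refl

  sm⪯ : ∀ S → sm ⪯ S
  sm⪯ S with S ≟ᶠ sm
  ... | yes S≡sm = inj₂ (sym S≡sm)
  ... | no  S≢sm = inj₁ (proj₁ (proj₂ SE) S S≢sm)

  ex-mono-≺ : ∀ {S T} → S ≺ T → ex S < ex T
  ex-mono-≺ {S} S≺T = ∸-monoˡ-< (SM _ _ S≺T) (∣∣-mono (sm⪯ S))

  ex-mono-⪯ : ∀ {S T} → S ⪯ T → ex S ≤ ex T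
  ex-mono-⪯ S⪯T = ∸-monoˡ-≤ ∣ set sm ∣ (∣∣-mono S⪯T)

  -- The common `∣ set sm ∣` cancels because `sm` is smallest; exponents written with `ex` become
  -- differences of cardinalities, to which LVS applies.
  ex∸ex : ∀ S T → ex T ∸ ex S ≡ ∣ set T ∣ ∸ ∣ set S ∣
  ex∸ex S T = trans (∸-+-assoc ∣ set T ∣ ∣ set sm ∣ (ex S))
                    (cong (∣ set T ∣ ∸_) (m+[n∸m]≡n (∣∣-mono (sm⪯ S))))

  -- Witnesses and charges.

  witness-⪯-excluder : ∀ {S v T T′} → v ∈ set S → IsWitness S v T → Excludes S v T′ → T ⪯ T′
  witness-⪯-excluder {S} {v} v∈S T-wit T′-exc with minimal-below (excludes? S v) T′-exc
  -- The minimal excluder `W` at or below `T′` is a witness, hence equal to `T` by SW.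
  ... | W , W⪯T′ , W-wit = subst (_⪯ _) (SW S v v∈S _ _ W-wit T-wit) W⪯T′

  -- T is charged, at level ex T, for the disappearance of v from hat S.
  Charge : ℕ → 𝐅 → 𝐅 → Fin n → Set
  Charge y T S v = ex T ≡ y × IsWitness S v T × v ∈ hat S

  charge? : ∀ y T S v → Dec (Charge y T S v)
  charge? y T S v = (ex T ≟ y) ×-dec isWitness? S v T ×-dec (v ∈? hat S)

  -- `S` is a minimal set containing `v` at or below a predecessor `P` of `T` that contains `v`.
  -- Minimality puts `v` in `hat S`, and `S ⪯ P` together with LVS bounds its size.
  visible⇒charge : ∀ {T v} → v ∈ Vis T ─ set T →
                   ∃ λ S → Charge (ex T) T S v × ∣ set S ∣ ≤ ∣ Vis T ∣
  visible⇒charge {T} {v} v∈ with ∈-comprehension⁻ (visible? T) (p─q⊆p (Vis T) (set T) v∈)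
  ... | (P , P∈Pred , v∈P) , uncovered with minimal-below (λ S → v ∈? set S) {P} v∈P
  ...   | S , S⪯P , v∈S , minimal =
    S , (refl , ((S≺T , x∈p∧x∉q⇒x∈p─q v∈S v∉T) , no-earlier) , v∈hatS)
      , ≤-trans (∣∣-mono S⪯P) (LVS T P P∈Pred)
    where
    S≺T : S ≺ T
    S≺T = ⪯-≺-trans S⪯P (proj₁ P∈Pred)

    v∉T : v ∉ set T
    v∉T = x∈p─q⇒x∉q (Vis T) (set T) v∈

    v∈hatS : v ∈ hat S
    v∈hatS = ∈-hat⁺ v∈S λ S′≺S v∈S′ → minimal (_ , v∈S′ , S′≺S)

    -- An excluder `U` strictly below `T` is at or below a predecessor `Q`. By TE the vertex stays
    -- out at `Q`, so `Q` covers `v` through `S`, against visibility.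
    no-earlier : ¬ (∃ λ U → Excludes S v U × U ≺ T)
    no-earlier (U , (S≺U , v∈S─U) , U≺T) with pred-above U≺T
    ... | Q , inj₂ refl , Q∈Pred = uncovered (Q , Q∈Pred , S , S≺U , v∈S─U)
    ... | Q , inj₁ U≺Q  , Q∈Pred =
      uncovered (Q , Q∈Pred , S , ≺-⪯-trans S≺U (inj₁ U≺Q) , TE S U Q v S≺U U≺Q v∈S─U)

  -- An excluder of excess at most `x` would lie at or above the witness `T`, whose excess is
  -- already `suc x`.
  charge⇒∈hatAt : ∀ {x T S v} → Charge (suc x) T S v → v ∈ hatAt x S
  charge⇒∈hatAt {x} {T} {S} {v} (exT , T-wit , v∈hat) = ∈-comprehension⁺ (inHat? x S)
    (v∈hat , λ (T′ , exT′≤x , T′-exc) → 1+n≰n (begin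
      suc x  ≡⟨ exT ⟨
      ex T   ≤⟨ ex-mono-⪯ (witness-⪯-excluder (hat⊆set S v∈hat) T-wit T′-exc) ⟩
      ex T′  ≤⟨ exT′≤x ⟩
      x      ∎))
    where open ≤-Reasoning

  charge⇒∉hatAt-suc : ∀ {x T S v} → Charge (suc x) T S v → v ∉ hatAt (suc x) S
  charge⇒∉hatAt-suc {x} {T} {S} (exT , (T-exc , _) , _) v∈ =
    proj₂ (∈-comprehension⁻ (inHat? (suc x) S) v∈) (T , ≤-reflexive exT , T-exc)

  hatAt-suc-⊆ : ∀ x S → hatAt (suc x) S ⊆ hatAt x S
  hatAt-suc-⊆ x S v∈ with ∈-comprehension⁻ (inHat? (suc x) S) v∈
  ... | v∈hat , kept = ∈-comprehension⁺ (inHat? x S)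
    (v∈hat , λ (T , exT≤x , T-exc) → kept (T , m≤n⇒m≤1+n exT≤x , T-exc))

  hatAt⊆hat : ∀ x S → hatAt x S ⊆ hat S
  hatAt⊆hat x S v∈ = proj₁ (∈-comprehension⁻ (inHat? x S) v∈)

  charges : ℕ → 𝐅 → 𝐅 → ℕ
  charges y T S = ∑[ v < n ] ⟦ charge? y T S v ⟧

  -- Counted vertex by vertex: a charged vertex belongs to `hatAt x S` but no longer to
  -- `hatAt (suc x) S`, so survivors and charged vertices are disjoint, and no vertex is charged
  -- twice for the same `S`.
  hatAt-suc+charges≤hatAt : ∀ x S →
    ∣ hatAt (suc x) S ∣ + ∑[ T < size ] charges (suc x) T S ≤ ∣ hatAt x S ∣
  hatAt-suc+charges≤hatAt x S = begin
    ∣ hatAt (suc x) S ∣ + ∑[ T < size ] charges (suc x) T S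
      ≡⟨ cong₂ _+_ (∣p∣≡∑ (hatAt (suc x) S)) (∑-comm {size} {n} (λ T v → ⟦ charge? (suc x) T S v ⟧)) ⟩
    ∑[ v < n ] ⟦ v ∈? hatAt (suc x) S ⟧ + ∑[ v < n ] ∑[ T < size ] ⟦ charge? (suc x) T S v ⟧
      ≡⟨ ∑-distrib-+ {n} _ _ ⟨
    ∑[ v < n ] (⟦ v ∈? hatAt (suc x) S ⟧ + ∑[ T < size ] ⟦ charge? (suc x) T S v ⟧)
      ≤⟨ ∑-mono pointwise ⟩
    ∑[ v < n ] ⟦ v ∈? hatAt x S ⟧
      ≡⟨ ∣p∣≡∑ (hatAt x S) ⟨
    ∣ hatAt x S ∣ ∎
    where
    open ≤-Reasoning
    uncharged : ∀ {v} → (∀ {T} → ¬ Charge (suc x) T S v) →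
                ∑[ T < size ] ⟦ charge? (suc x) T S v ⟧ ≡ 0
    uncharged {v} ¬c = ∑-zero λ T → ⟦⟧-false (charge? (suc x) T S v) ¬c

    pointwise : ∀ v → ⟦ v ∈? hatAt (suc x) S ⟧ + ∑[ T < size ] ⟦ charge? (suc x) T S v ⟧
                      ≤ ⟦ v ∈? hatAt x S ⟧
    pointwise v with v ∈? hatAt (suc x) S | v ∈? hatAt x S
    ... | yes v∈ | yes _  = s≤s (≤-reflexive (uncharged λ c → charge⇒∉hatAt-suc c v∈))
    ... | yes v∈ | no v∉  = contradiction (hatAt-suc-⊆ x S v∈) v∉
    ... | no _   | no v∉  = ≤-reflexive (uncharged λ c → v∉ (charge⇒∈hatAt c))
    -- Two charging sets would be two witnesses of `v` w.r.t. `S`.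
    ... | no _   | yes v∈ = ∑⟦⟧≤1 (λ T → charge? (suc x) T S v)
      λ (_ , T-wit , v∈hat) (_ , T′-wit , _) → SW S v (hat⊆set S v∈hat) _ _ T-wit T′-wit

  -- Every vertex of `Vis T ─ set T` yields a charge of weight at least `2 ^ d`, and their total
  -- dominates the bound of `∣hat∣≤`.
  ∣hat∣≤charges : ∀ {y} T → ex T ≡ suc y →
    ∣ hat T ∣ ≤ ∑[ S < size ] (2 ^ (suc y ∸ ex S) * charges (suc y) T S)
  ∣hat∣≤charges {y} T exT = begin
    ∣ hat T ∣
      ≤⟨ ∣hat∣≤ T ⟩
    ∣ Vis T ─ set T ∣ + d
      ≤⟨ k+d≤2^d*k d 0<k ⟩
    2 ^ d * ∣ Vis T ─ set T ∣
      ≡⟨ cong (2 ^ d *_) (∣p∣≡∑ (Vis T ─ set T)) ⟩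
    2 ^ d * ∑[ v < n ] ⟦ v ∈? Vis T ─ set T ⟧
      ≡⟨ *-distribˡ-sum {n} (2 ^ d) _ ⟩
    ∑[ v < n ] (2 ^ d * ⟦ v ∈? Vis T ─ set T ⟧)
      ≤⟨ ∑-mono pointwise ⟩
    ∑[ v < n ] ∑[ S < size ] (w S * ⟦ charge? (suc y) T S v ⟧)
      ≡⟨ ∑-comm {n} {size} (λ v S → w S * ⟦ charge? (suc y) T S v ⟧) ⟩
    ∑[ S < size ] ∑[ v < n ] (w S * ⟦ charge? (suc y) T S v ⟧)
      ≡⟨ sum-cong-≗ {size} (λ S → *-distribˡ-sum {n} (w S) (λ v → ⟦ charge? (suc y) T S v ⟧)) ⟨
    ∑[ S < size ] (w S * charges (suc y) T S) ∎
    where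
    open ≤-Reasoning
    d : ℕ
    d = ∣ set T ∣ ∸ ∣ Vis T ∣

    w : 𝐅 → ℕ
    w S = 2 ^ (suc y ∸ ex S)

    T≢sm : T ≢ sm
    T≢sm refl = contradiction (trans (sym exT) (n∸n≡0 ∣ set sm ∣)) λ ()

    -- If the difference were empty, `Vis T` would be contained in `set T`, contradicting DVS.
    0<k : 0 < ∣ Vis T ─ set T ∣
    0<k = n≢0⇒n>0 λ k≡0 → DVS T T≢sm λ {v} v∈Vis → decidable-stable (v ∈? set T) λ v∉T →
      1+n≰n (begin
        1                                    ≡⟨ ⟦⟧-true (v ∈? Vis T ─ set T) (x∈p∧x∉q⇒x∈p─q v∈Vis v∉T) ⟨
        ⟦ v ∈? Vis T ─ set T ⟧               ≤⟨ term≤∑ (λ u → ⟦ u ∈? Vis T ─ set T ⟧) v ⟩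
        ∑[ u < n ] ⟦ u ∈? Vis T ─ set T ⟧    ≡⟨ ∣p∣≡∑ (Vis T ─ set T) ⟨
        ∣ Vis T ─ set T ∣                    ≡⟨ k≡0 ⟩
        0                                    ∎)

    -- A charged `S` is no larger than `Vis T`, so its distance to `T` in size is at least `d`.
    d≤ : ∀ {S} → ∣ set S ∣ ≤ ∣ Vis T ∣ → d ≤ suc y ∸ ex S
    d≤ {S} ∣S∣≤ = begin
      ∣ set T ∣ ∸ ∣ Vis T ∣  ≤⟨ ∸-monoʳ-≤ ∣ set T ∣ ∣S∣≤ ⟩
      ∣ set T ∣ ∸ ∣ set S ∣  ≡⟨ ex∸ex S T ⟨
      ex T ∸ ex S            ≡⟨ cong (_∸ ex S) exT ⟩
      suc y ∸ ex S           ∎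

    pointwise : ∀ v → 2 ^ d * ⟦ v ∈? Vis T ─ set T ⟧ ≤ ∑[ S < size ] (w S * ⟦ charge? (suc y) T S v ⟧)
    pointwise v with v ∈? Vis T ─ set T
    ... | no _   = ≤-trans (≤-reflexive (*-zeroʳ (2 ^ d))) z≤n
    ... | yes v∈ with visible⇒charge v∈
    ...   | S , charge , ∣S∣≤ = begin
      2 ^ d * 1                                         ≤⟨ *-monoˡ-≤ 1 (^-monoʳ-≤ 2 (d≤ {S} ∣S∣≤)) ⟩
      w S * 1                                           ≡⟨ cong (w S *_) (⟦⟧-true (charge? (suc y) T S v) (subst (λ z → Charge z T S v) exT charge)) ⟨
      -- One charged `S` per visible vertex suffices; further ones only enlarge the sum.
      w S * ⟦ charge? (suc y) T S v ⟧                   ≤⟨ term≤∑ (λ S → w S * ⟦ charge? (suc y) T S v ⟧) S ⟩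
      ∑[ S < size ] (w S * ⟦ charge? (suc y) T S v ⟧)   ∎

  -- The growth of `M`.

  M-term : ℕ → 𝐅 → ℕ
  M-term x S = ⟦ ex S ≤? x ⟧ * (2 ^ (x ∸ ex S) * ∣ hatAt x S ∣)

  -- The indicator in `M-term` matters: for `ex S > x` the truncated exponent would give weight `1`,
  -- not `0`.
  M≡∑ : ∀ x → M x ≡ ∑[ S < size ] M-term x S
  M≡∑ x = sum-filter-tabulate (λ S → ex S ≤? x) (λ S → 2 ^ (x ∸ ex S) * ∣ hatAt x S ∣) id

  -- The charges first appear grouped by the charging set `T`; interchanging the sums regroups them
  -- by the charged set `S`, where they compete with the survivors for the room in `hatAt x S`.
  M-suc : ∀ x → M (suc x) ≤ 2 * M x
  M-suc x = begin
    M (suc x)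
      ≡⟨ M≡∑ (suc x) ⟩
    ∑[ S < size ] M-term (suc x) S
      ≤⟨ ∑-mono split ⟩
    ∑[ S < size ] (old S + ∑[ S′ < size ] (w S′ * charges (suc x) S S′))
      ≡⟨ ∑-distrib-+ {size} old _ ⟩
    ∑[ S < size ] old S + ∑[ T < size ] ∑[ S < size ] (w S * charges (suc x) T S)
      ≡⟨ cong (sum old +_) (∑-comm {size} {size} (λ T S → w S * charges (suc x) T S)) ⟩
    ∑[ S < size ] old S + ∑[ S < size ] ∑[ T < size ] (w S * charges (suc x) T S)
      ≡⟨ cong (sum old +_) (sum-cong-≗ {size} λ S → *-distribˡ-sum {size} (w S) (λ T → charges (suc x) T S)) ⟨
    ∑[ S < size ] old S + ∑[ S < size ] (w S * ∑[ T < size ] charges (suc x) T S)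
      ≡⟨ ∑-distrib-+ {size} old _ ⟨
    ∑[ S < size ] (old S + w S * ∑[ T < size ] charges (suc x) T S)
      ≤⟨ ∑-mono pay ⟩
    ∑[ S < size ] (2 * M-term x S)
      ≡⟨ *-distribˡ-sum {size} 2 (M-term x) ⟨
    2 * ∑[ S < size ] M-term x S
      ≡⟨ cong (2 *_) (M≡∑ x) ⟨
    2 * M x ∎
    where
    open ≤-Reasoning
    w : 𝐅 → ℕ
    w S = 2 ^ (suc x ∸ ex S)

    -- Sets already present at level `x`, with the doubled weight but the shrunken hat of level
    -- `suc x`.
    old : 𝐅 → ℕ
    old S = ⟦ ex S ≤? x ⟧ * (w S * ∣ hatAt (suc x) S ∣)

    split : ∀ S → M-term (suc x) S ≤ old S + ∑[ S′ < size ] (w S′ * charges (suc x) S S′)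
    split S = by-cases (ex S ≤? suc x) (ex S ≤? x)
      where
      -- Taking the decisions as arguments lets matching on them evaluate the indicators.
      by-cases : (a : Dec (ex S ≤ suc x)) (b : Dec (ex S ≤ x)) →
        ⟦ a ⟧ * (w S * ∣ hatAt (suc x) S ∣) ≤
        ⟦ b ⟧ * (w S * ∣ hatAt (suc x) S ∣) + ∑[ S′ < size ] (w S′ * charges (suc x) S S′)
      by-cases (no _)  _       = z≤n
      by-cases (yes _) (yes _) = m≤m+n _ _
      -- Here `ex S` is exactly `suc x`: the weight is `2 ^ 0`, and the hat is paid for by charges.
      by-cases (yes ex≤) (no ex≰) = begin
        1 * (w S * ∣ hatAt (suc x) S ∣)  ≡⟨ *-identityˡ _ ⟩
        w S * ∣ hatAt (suc x) S ∣        ≡⟨ cong (λ e → 2 ^ e * ∣ hatAt (suc x) S ∣) (m≤n⇒m∸n≡0 (≰⇒> ex≰)) ⟩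
        1 * ∣ hatAt (suc x) S ∣          ≡⟨ *-identityˡ _ ⟩
        ∣ hatAt (suc x) S ∣              ≤⟨ p⊆q⇒∣p∣≤∣q∣ (hatAt⊆hat (suc x) S) ⟩
        ∣ hat S ∣                        ≤⟨ ∣hat∣≤charges S (≤-antisym ex≤ (≰⇒> ex≰)) ⟩
        ∑[ S′ < size ] (w S′ * charges (suc x) S S′) ∎

    pay : ∀ S → old S + w S * ∑[ T < size ] charges (suc x) T S ≤ 2 * M-term x S
    pay S = by-cases (ex S ≤? x)
      where
      -- A charged `S` lies strictly below a set of excess `suc x`, so sets beyond level `x`
      -- contribute nothing to the regrouped sum.
      uncharged : ¬ (ex S ≤ x) → ∀ {T v} → ¬ Charge (suc x) T S v
      uncharged ex≰ (exT , ((S≺T , _) , _) , _) =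
        ex≰ (s≤s⁻¹ (subst (ex S <_) exT (ex-mono-≺ S≺T)))

      by-cases : (a : Dec (ex S ≤ x)) →
        ⟦ a ⟧ * (w S * ∣ hatAt (suc x) S ∣) + w S * ∑[ T < size ] charges (suc x) T S ≤
        2 * (⟦ a ⟧ * (2 ^ (x ∸ ex S) * ∣ hatAt x S ∣))
      by-cases (no ex≰)    = ≤-reflexive (trans
        (cong (w S *_) (∑-zero {size} λ T → ∑-zero {n} λ v →
          ⟦⟧-false (charge? (suc x) T S v) (uncharged ex≰)))
        (*-zeroʳ (w S)))
      by-cases (yes exS≤x) = begin
        1 * (w S * ∣ hatAt (suc x) S ∣) + w S * ∑[ T < size ] charges (suc x) T S
          ≡⟨ cong (_+ w S * ∑[ T < size ] charges (suc x) T S) (*-identityˡ _) ⟩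
        w S * ∣ hatAt (suc x) S ∣ + w S * ∑[ T < size ] charges (suc x) T S
          ≡⟨ *-distribˡ-+ (w S) ∣ hatAt (suc x) S ∣ _ ⟨
        w S * (∣ hatAt (suc x) S ∣ + ∑[ T < size ] charges (suc x) T S)
          ≤⟨ *-monoʳ-≤ (w S) (hatAt-suc+charges≤hatAt x S) ⟩
        w S * ∣ hatAt x S ∣
          -- The factor `2`: since `ex S ≤ x`, the exponent `suc x ∸ ex S` is `suc (x ∸ ex S)`.
          ≡⟨ cong (λ e → 2 ^ e * ∣ hatAt x S ∣) (+-∸-assoc 1 exS≤x) ⟩
        2 * 2 ^ (x ∸ ex S) * ∣ hatAt x S ∣
          ≡⟨ *-assoc 2 (2 ^ (x ∸ ex S)) _ ⟩
        2 * (2 ^ (x ∸ ex S) * ∣ hatAt x S ∣)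
          ≡⟨ cong (2 *_) (*-identityˡ (2 ^ (x ∸ ex S) * ∣ hatAt x S ∣)) ⟨
        2 * (1 * (2 ^ (x ∸ ex S) * ∣ hatAt x S ∣)) ∎

  -- Any other set is strictly above `sm` and has positive excess, so only the term of `sm`
  -- survives.
  M-zero : M 0 ≤ ∣ set sm ∣
  M-zero = begin
    M 0                                          ≡⟨ M≡∑ 0 ⟩
    ∑[ S < size ] M-term 0 S                     ≤⟨ ∑-mono term≤ ⟩
    ∑[ S < size ] (∣ set sm ∣ * ⟦ S ≟ᶠ sm ⟧)     ≡⟨ *-distribˡ-sum {size} ∣ set sm ∣ (λ S → ⟦ S ≟ᶠ sm ⟧) ⟨
    ∣ set sm ∣ * ∑[ S < size ] ⟦ S ≟ᶠ sm ⟧       ≤⟨ *-monoʳ-≤ ∣ set sm ∣ (∑⟦⟧≤1 (_≟ᶠ sm) λ p q → trans p (sym q)) ⟩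
    ∣ set sm ∣ * 1                               ≡⟨ *-identityʳ _ ⟩
    ∣ set sm ∣                                   ∎
    where
    open ≤-Reasoning
    term≤ : ∀ S → M-term 0 S ≤ ∣ set sm ∣ * ⟦ S ≟ᶠ sm ⟧
    term≤ S = by-cases (ex S ≤? 0) (S ≟ᶠ sm)
      where
      by-cases : (a : Dec (ex S ≤ 0)) (b : Dec (S ≡ sm)) →
        ⟦ a ⟧ * (2 ^ (0 ∸ ex S) * ∣ hatAt 0 S ∣) ≤ ∣ set sm ∣ * ⟦ b ⟧
      by-cases (no _)     _         = z≤n
      by-cases (yes ex≤0) (no S≢sm) =
        contradiction (≤-trans (ex-mono-≺ (proj₁ (proj₂ SE) S S≢sm)) ex≤0) λ ()
      by-cases (yes _)    (yes refl) = begin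
        1 * (2 ^ (0 ∸ ex sm) * ∣ hatAt 0 sm ∣)  ≡⟨ *-identityˡ _ ⟩
        2 ^ (0 ∸ ex sm) * ∣ hatAt 0 sm ∣        ≡⟨ cong (λ e → 2 ^ e * ∣ hatAt 0 sm ∣) (0∸n≡0 (ex sm)) ⟩
        1 * ∣ hatAt 0 sm ∣                      ≡⟨ *-identityˡ _ ⟩
        ∣ hatAt 0 sm ∣                          ≤⟨ p⊆q⇒∣p∣≤∣q∣ (λ v∈ → hat⊆set sm (hatAt⊆hat 0 sm v∈)) ⟩
        ∣ set sm ∣                              ≡⟨ *-identityʳ _ ⟨
        ∣ set sm ∣ * 1                          ∎

  M≤2^x*∣sm∣ : ∀ x → M x ≤ 2 ^ x * ∣ set sm ∣
  M≤2^x*∣sm∣ zero    = ≤-trans M-zero (≤-reflexive (sym (*-identityˡ _)))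
  M≤2^x*∣sm∣ (suc x) = begin
    M (suc x)                  ≤⟨ M-suc x ⟩
    2 * M x                    ≤⟨ *-monoʳ-≤ 2 (M≤2^x*∣sm∣ x) ⟩
    2 * (2 ^ x * ∣ set sm ∣)   ≡⟨ *-assoc 2 (2 ^ x) _ ⟨
    2 ^ suc x * ∣ set sm ∣     ∎
    where open ≤-Reasoning

theorem2 : ∀ {n : ℕ} (model : CostModel) (fam : OrderedFamily n)
    (is : IsISFamily model fam) (x : ℕ) →
    IsISFamily.M is x ≤ 2 ^ x * ∣ OrderedFamily.set fam (IsISFamily.sm is) ∣
theorem2 model fam is = ISFamilyProperties.M≤2^x*∣sm∣ model fam is
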